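{- Let $\lambda, v, u$ be positive integers and let $M=m_1,m_2,\ldots,m_t$ be a sequence of integers with $m_1\leq m_2\leq\cdots\leq m_t$ and $m_i\equiv 0\pmod{2}$ for all $i\in\{1,2,\ldots,t\}$. If there exists an $(M)$-cycle decomposition of $\lambda K_{v,u}$, then all of the following hold: (a) $m_t\leq 2\min(\{v,u\})$; (b) $\lambda v\equiv \lambda u\equiv 0\pmod{2}$; (c) $t\leq \frac{\lambda}{2}vu-m_t+2$ if $\lambda$ is even; (d) $2\nu_2(M)\leq (\lambda-1)vu$ if $\lambda$ is odd.
   Context: $\lambda K_{v,u}$ denotes the multigraph with vertex set $V\cup U$, where $V,U$ are disjoint, $|V|=v$, $|U|=u$, in which every $x\in V$ and $y\in U$ are joined by exactly $\lambda$ parallel edges and there are no other edges. For $m\geq 2$, an $m$-cycle is a subgraph consisting of $m$ distinct vertices $x_0,\ldots,x_{m-1}$ and one edge joining $x_i$ and $x_{i+1}$ for each $i$ (indices mod $m$); in particular a $2$-cycle consists of two parallel edges between two vertices. An $(M)$-cycle decomposition of a multigraph $G$, for $M=m_1,\ldots,m_t$, is a partition of the edge set of $G$ into $t$ cycles of lengths $m_1,\ldots,m_t$ respectively. $\nu_k(M)$ denotes the number of indices $i$ with $m_i=k$. -}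

module Defs where

open import Data.Fin.Base using (Fin; toℕ)
open import Data.Nat.Base using (ℕ; suc; _≤_)
open import Data.Nat.DivMod using (_mod_)
open import Data.Nat.Properties using (_≟_)
open import Data.Product using (_×_; _,_; ∃; ∃!)
open import Data.Sum.Base using (_⊎_; inj₁; inj₂)
open import Data.Vec.Base using (Vec; count; lookup)
open import Function.Definitions using (Injective)
open import Relation.Binary.PropositionalEquality using (_≡_)

record Multigraph : Set₁ where
  field
    Vertex : Set
    Edge   : Set
    -- The order of the two endpoints carries no meaning; see Joins.
    ends   : Edge → Vertex × Vertex

  Joins : Edge → Vertex → Vertex → Set
  Joins e x y = ends e ≡ (x , y) ⊎ ends e ≡ (y , x)

-- λK_{v,u}; the last component of an edge tells parallel edges apart.
completeBipartite : (ƛ v u : ℕ) → Multigraph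
completeBipartite ƛ v u = record
  { Vertex = Fin v ⊎ Fin u
  ; Edge   = Fin v × Fin u × Fin ƛ
  ; ends   = λ (x , y , _) → inj₁ x , inj₂ y
  }

-- i ↦ i + 1 (mod m)
next : ∀ {m} → Fin m → Fin m
next {suc m} i = suc (toℕ i) mod suc m

-- A cycle subgraph, presented by a cyclic enumeration of its vertices and edges.
record Cycle (G : Multigraph) (m : ℕ) : Set where
  open Multigraph G
  field
    2≤m              : 2 ≤ m
    vertex           : Fin m → Vertex
    vertex-injective : Injective _≡_ _≡_ vertex
    edge             : Fin m → Edge
    -- Only a restriction when m = 2: the two edges are parallel, not equal.
    edge-injective   : Injective _≡_ _≡_ edge
    joins            : ∀ i → Joins (edge i) (vertex i) (vertex (next i))

infix 4 _∈ᴱ_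

_∈ᴱ_ : ∀ {G m} → Multigraph.Edge G → Cycle G m → Set
e ∈ᴱ C = ∃ λ j → Cycle.edge C j ≡ e

record CycleDecomposition {t : ℕ} (M : Vec ℕ t) (G : Multigraph) : Set where
  field
    cycle     : (i : Fin t) → Cycle G (lookup M i)
    partition : ∀ e → ∃! _≡_ λ i → e ∈ᴱ cycle i

ν : ∀ {t} → ℕ → Vec ℕ t → ℕ
ν k M = count (_≟ k) M

{-# OPTIONS --safe #-}
module Submission where

-- Everything is a double count of edges over (cycle, position in the cycle).
-- (a) The two sides alternate along a cycle. (b) A cycle has degree 0 or 2 at
-- each vertex. (d) A pair {a, b} carries an even number of edges lying in
-- 2-cycles, hence at most ƛ ∸ 1 of its ƛ edges.
-- (c) Let C be a cycle of length m. Start with W = two consecutive vertices of C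
-- and, as long as some other cycle D meets W in at least two vertices, add the
-- vertices of D to W, at most |D| ∸ 2 new ones. In the end every cycle other than
-- C lies inside W or meets it in at most one vertex, so at each y ∈ W it has an
-- even number of edges from y into W. For even ƛ the total number of such edges
-- is even, hence so is the number belonging to C: with two consecutive vertices
-- W contains the next one, thus all of C. So m ≤ |W| ≤ 2 + Σ_{D ≠ C} (|D| ∸ 2),
-- which is (c) because the lengths add up to ƛvu.

open import Defs
open import Data.Nat.Base using (ℕ; zero; suc; z≤n; s≤s; _≤_; _<_; _+_; _*_; _∸_; _/_; _%_; _⊓_; NonZero)
open import Data.Nat.Divisibility
  using (_∣_; _∣0; ∣-refl; ∣m∣n⇒∣m+n; ∣m+n∣m⇒∣n; m∣m*n; ∣m⇒∣m*n; ∣1⇒≡1)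
open import Data.Integer.Base as ℤ using (+_)
open import Data.Product using (_×_; _,_; proj₁; proj₂; Σ; ∃; ∃!)
open import Data.Vec.Base using (Vec; []; _∷_; last; lookup)
open import Data.Vec.Relation.Unary.All using (All)
open import Data.Vec.Relation.Unary.Linked using (Linked)
open import Relation.Nullary using (¬_; yes; no; does; contradiction)

open import Algebra.Properties.CommutativeSemigroup using (interchange)
import Data.Nat.Properties as ℕ
import Algebra.Properties.Semiring.Sum ℕ.+-*-semiring as Sum
import Data.Bool.Properties as Bool
open import Data.Bool.Properties using (∨-zeroʳ)
open import Data.Bool.Base using (Bool; true; false; _∨_; _∧_; not; if_then_else_)
open import Data.Fin.Base using (Fin; zero; suc; toℕ; fromℕ; inject₁)
open import Data.Fin.Induction using (<-weakInduction)
open import Data.Fin.Permutation using (Permutation; permutation; _⟨$⟩ʳ_)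
import Data.Fin.Properties as Fin
open import Data.Fin.Relation.Unary.Top using (view; ‵fromℕ; ‵inject₁)
open import Data.Nat.DivMod using (m<n⇒m%n≡m; n%n≡0; m/n*n≡m)
import Data.Nat.Solver as ℕSolver
import Data.Integer.Properties as ℤ
import Data.Integer.Solver as ℤSolver
import Data.Product.Properties as Product
open import Data.Sum.Base using (inj₁; inj₂)
import Data.Sum.Properties as ⊎
open import Function.Base using (_∘_; id)
open import Relation.Binary.Definitions using (DecidableEquality)
open import Relation.Binary.PropositionalEquality
  using (_≡_; _≢_; refl; sym; trans; cong; cong₂; subst; module ≡-Reasoning)
open import Relation.Nullary.Decidable using (dec-true; dec-false; _×-dec_)

-- Finite sums of natural numbers and their divisibility.

# : Bool → ℕ
# true  = 1
# false = 0

-- Opaque, so that unification sees sum as a rigid symbol.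
opaque

  sum : ∀ {n} → (Fin n → ℕ) → ℕ
  sum = Sum.sum

  sum-suc : ∀ {n} (f : Fin (suc n) → ℕ) → sum f ≡ f zero + sum (f ∘ suc)
  sum-suc f = refl

  sum-[] : ∀ (f : Fin 0 → ℕ) → sum f ≡ 0
  sum-[] f = refl

  sum-cong : ∀ {n} {f g : Fin n → ℕ} → (∀ i → f i ≡ g i) → sum f ≡ sum g
  sum-cong = Sum.sum-cong-≗

  sum-distrib-+ : ∀ {n} (f g : Fin n → ℕ) → sum (λ i → f i + g i) ≡ sum f + sum g
  sum-distrib-+ = Sum.∑-distrib-+

  sum-comm : ∀ {m n} (f : Fin m → Fin n → ℕ) →
    sum (λ i → sum λ j → f i j) ≡ sum (λ j → sum λ i → f i j)
  sum-comm = Sum.∑-comm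

  sum-permute : ∀ {m n} (f : Fin n → ℕ) (π : Permutation m n) → sum f ≡ sum (λ i → f (π ⟨$⟩ʳ i))
  sum-permute = Sum.sum-permute

  *-distribˡ-sum : ∀ {n} k (f : Fin n → ℕ) → k * sum f ≡ sum (λ i → k * f i)
  *-distribˡ-sum = Sum.*-distribˡ-sum

  sum-zero : ∀ {n} (f : Fin n → ℕ) → (∀ i → f i ≡ 0) → sum f ≡ 0
  sum-zero {zero}  f f≡0 = refl
  sum-zero {suc n} f f≡0 = cong₂ _+_ (f≡0 zero) (sum-zero (f ∘ suc) (f≡0 ∘ suc))

  sum-const : ∀ n c → sum {n} (λ _ → c) ≡ n * c
  sum-const zero    c = refl
  sum-const (suc n) c = cong (_+_ c) (sum-const n c)

  sum-≤ : ∀ {n} {f g : Fin n → ℕ} → (∀ i → f i ≤ g i) → sum f ≤ sum g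
  sum-≤ {zero}  f≤g = z≤n
  sum-≤ {suc n} f≤g = ℕ.+-mono-≤ (f≤g zero) (sum-≤ (f≤g ∘ suc))

  sum-single : ∀ {n} (f : Fin n → ℕ) i → (∀ j → j ≢ i → f j ≡ 0) → sum f ≡ f i
  sum-single f zero    f≡0 =
    trans (cong (_+_ (f zero)) (sum-zero (f ∘ suc) λ j → f≡0 (suc j) λ ())) (ℕ.+-identityʳ _)
  sum-single f (suc i) f≡0 =
    cong₂ _+_ (f≡0 zero λ ()) (sum-single (f ∘ suc) i λ j j≢i → f≡0 (suc j) (j≢i ∘ Fin.suc-injective))

  term≤sum : ∀ {n} (f : Fin n → ℕ) i → f i ≤ sum f
  term≤sum f zero    = ℕ.m≤m+n _ _
  term≤sum f (suc i) = ℕ.≤-trans (term≤sum (f ∘ suc) i) (ℕ.m≤n+m _ _)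

  two-terms≤sum : ∀ {n} (f : Fin n → ℕ) i j → i ≢ j → f i + f j ≤ sum f
  two-terms≤sum f zero    zero    i≢j = contradiction refl i≢j
  two-terms≤sum f zero    (suc j) i≢j = ℕ.+-monoʳ-≤ (f zero) (term≤sum (f ∘ suc) j)
  two-terms≤sum f (suc i) zero    i≢j =
    ℕ.≤-trans (ℕ.≤-reflexive (ℕ.+-comm (f (suc i)) _)) (ℕ.+-monoʳ-≤ (f zero) (term≤sum (f ∘ suc) i))
  two-terms≤sum f (suc i) (suc j) i≢j =
    ℕ.≤-trans (two-terms≤sum (f ∘ suc) i j (i≢j ∘ cong suc)) (ℕ.m≤n+m _ _)

  ∣-sum : ∀ {d n} (f : Fin n → ℕ) → (∀ i → d ∣ f i) → d ∣ sum f
  ∣-sum {n = zero}  f d∣f = _ ∣0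
  ∣-sum {n = suc n} f d∣f = ∣m∣n⇒∣m+n (d∣f zero) (∣-sum (f ∘ suc) (d∣f ∘ suc))

  -- Serves the parity step of (c): the total is even and every other cycle contributes evenly, so
  -- the one remaining cycle does too.
  ∣-sum⇒∣-term : ∀ {d n} (f : Fin n → ℕ) i → (∀ j → j ≢ i → d ∣ f j) → d ∣ sum f → d ∣ f i
  ∣-sum⇒∣-term {d} f zero d∣f d∣Σ =
    ∣m+n∣m⇒∣n (subst (d ∣_) (ℕ.+-comm (f zero) (sum (f ∘ suc))) d∣Σ) (∣-sum (f ∘ suc) λ j → d∣f (suc j) λ ())
  ∣-sum⇒∣-term f (suc i) d∣f d∣Σ =
    ∣-sum⇒∣-term (f ∘ suc) i (λ j j≢i → d∣f (suc j) (j≢i ∘ Fin.suc-injective))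
      (∣m+n∣m⇒∣n d∣Σ (d∣f zero λ ()))

sum-syntax : ∀ n → (Fin n → ℕ) → ℕ
sum-syntax _ = sum

infixl 10 sum-syntax
syntax sum-syntax n (λ i → x) = ∑[ i < n ] x

-- Kronecker deltas as summation weights.

module _ {A : Set} (_≟_ : DecidableEquality A) where

  opaque

    δ : A → A → ℕ
    δ x y = # (does (x ≟ y))

    δ-does : ∀ x y → δ x y ≡ # (does (x ≟ y))
    δ-does x y = refl

    δ-≡ : ∀ {x y} → x ≡ y → δ x y ≡ 1
    δ-≡ x≡y = cong # (dec-true (_ ≟ _) x≡y)

    δ-≢ : ∀ {x y} → x ≢ y → δ x y ≡ 0
    δ-≢ x≢y = cong # (dec-false (_ ≟ _) x≢y)

    δ-≤1 : ∀ x y → δ x y ≤ 1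
    δ-≤1 x y with does (x ≟ y)
    ... | true  = ℕ.≤-refl
    ... | false = z≤n

  δ-≡-* : ∀ {x y} → x ≡ y → ∀ k → δ x y * k ≡ k
  δ-≡-* x≡y k = trans (cong (_* k) (δ-≡ x≡y)) (ℕ.*-identityˡ k)

  δ-≢-* : ∀ {x y} → x ≢ y → ∀ k → δ x y * k ≡ 0
  δ-≢-* x≢y k = cong (_* k) (δ-≢ x≢y)

sum-sift : ∀ {n} i (f : Fin n → ℕ) → ∑[ j < n ] (δ Fin._≟_ i j * f j) ≡ f i
sum-sift i f = trans
  (sum-single _ i λ j j≢i → δ-≢-* Fin._≟_ (j≢i ∘ sym) (f j))
  (δ-≡-* Fin._≟_ refl (f i))

-- The cyclic successor on positions.

prev : ∀ {m} → Fin m → Fin m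
prev zero    = fromℕ _
prev (suc i) = inject₁ i

next-inject₁ : ∀ {m} (i : Fin m) → next (inject₁ i) ≡ suc i
next-inject₁ {m} i = Fin.toℕ-injective (begin
  toℕ (next (inject₁ i))            ≡⟨ Fin.toℕ-fromℕ< _ ⟩
  suc (toℕ (inject₁ i)) % suc m     ≡⟨ cong (λ k → suc k % suc m) (Fin.toℕ-inject₁ i) ⟩
  suc (toℕ i) % suc m               ≡⟨ m<n⇒m%n≡m (s≤s (Fin.toℕ<n i)) ⟩
  suc (toℕ i)                       ∎)
  where open ≡-Reasoning

next-fromℕ : ∀ m → next (fromℕ m) ≡ zero
next-fromℕ m = Fin.toℕ-injective (begin
  toℕ (next (fromℕ m))              ≡⟨ Fin.toℕ-fromℕ< _ ⟩
  suc (toℕ (fromℕ m)) % suc m       ≡⟨ cong (λ k → suc k % suc m) (Fin.toℕ-fromℕ m) ⟩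
  suc m % suc m                     ≡⟨ n%n≡0 (suc m) ⟩
  0                                 ∎)
  where open ≡-Reasoning

next-prev : ∀ {m} (i : Fin m) → next (prev i) ≡ i
next-prev zero    = next-fromℕ _
next-prev (suc i) = next-inject₁ i

prev-next : ∀ {m} (i : Fin m) → prev (next i) ≡ i
prev-next i with view i
... | ‵fromℕ     = cong prev (next-fromℕ _)
... | ‵inject₁ j = cong prev (next-inject₁ j)

next-permutation : ∀ {m} → Permutation m m
next-permutation = permutation next prev next-prev prev-next

sum-next : ∀ {m} (f : Fin m → ℕ) → ∑[ i < m ] f (next i) ≡ sum f
sum-next f = sym (sum-permute f next-permutation)

next≢ : ∀ {m} → 2 ≤ m → (i : Fin m) → next i ≢ i
next≢ {suc (suc m)} (s≤s _) i eq with view i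
-- With `m` at least 2 the last index is a successor, while its `next` is `zero`.
... | ‵fromℕ     = Fin.0≢1+n (trans (sym (next-fromℕ _)) eq)
... | ‵inject₁ j = ℕ.1+n≢n (trans (cong toℕ (trans (sym (next-inject₁ j)) eq)) (Fin.toℕ-inject₁ j))

first : ∀ {m} → 2 ≤ m → Fin m
first (s≤s _) = zero

-- Ordinary induction along `Fin m`, phrased with `next` because `joins` relates positions only
-- through `next`.
next-induction : ∀ {m} (2≤m : 2 ≤ m) (P : Fin m → Set) →
  P (first 2≤m) → (∀ i → P i → P (next i)) → ∀ i → P i
next-induction (s≤s _) P P₀ step =
  <-weakInduction P P₀ λ i Pi → subst P (next-inject₁ i) (step (inject₁ i) Pi)

-- Subsets are Boolean characteristic functions; a sum over the subset `R` carries the weights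
-- `# (R j)`.
_⊖_ : ∀ {n} → (Fin n → Bool) → Fin n → Fin n → Bool
(R ⊖ i) j = R j ∧ not (does (i Fin.≟ j))

sum-⊖ : ∀ {n} (R : Fin n → Bool) i (f : Fin n → ℕ) → R i ≡ true →
  ∑[ j < n ] (# ((R ⊖ i) j) * f j) + f i ≡ ∑[ j < n ] (# (R j) * f j)
sum-⊖ {n} R i f Ri = begin
  ∑[ j < n ] (# ((R ⊖ i) j) * f j) + f i
    ≡⟨ cong (_+_ (∑[ j < n ] (# ((R ⊖ i) j) * f j))) (sym (sum-sift i f)) ⟩
  ∑[ j < n ] (# ((R ⊖ i) j) * f j) + ∑[ j < n ] (δ Fin._≟_ i j * f j)
    ≡⟨ sym (sum-distrib-+ _ _) ⟩
  ∑[ j < n ] (# ((R ⊖ i) j) * f j + δ Fin._≟_ i j * f j)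
    ≡⟨ sum-cong pointwise ⟩
  ∑[ j < n ] (# (R j) * f j) ∎
  where
  open ≡-Reasoning
  pointwise : ∀ j → # ((R ⊖ i) j) * f j + δ Fin._≟_ i j * f j ≡ # (R j) * f j
  pointwise j with i Fin.≟ j
  pointwise j | yes refl rewrite Ri = trans (δ-≡-* Fin._≟_ refl (f i)) (sym (ℕ.*-identityˡ (f i)))
  pointwise j | no i≢j with R j
  ... | true  = trans (cong (_+_ (1 * f j)) (δ-≢-* Fin._≟_ i≢j (f j))) (ℕ.+-identityʳ _)
  ... | false = δ-≢-* Fin._≟_ i≢j (f j)

-- Sums over the vertices and edges of the complete bipartite multigraph.

module _ {ƛ v u : ℕ} where

  G : Multigraph
  G = completeBipartite ƛ v u

  open Multigraph G
  open Cycle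

  _≟ᵛ_ : DecidableEquality Vertex
  _≟ᵛ_ = ⊎.≡-dec Fin._≟_ Fin._≟_

  _≟ᵉ_ : DecidableEquality Edge
  _≟ᵉ_ = Product.≡-dec Fin._≟_ (Product.≡-dec Fin._≟_ Fin._≟_)

  δᵛ : Vertex → Vertex → ℕ
  δᵛ = δ _≟ᵛ_

  Σᵛ : (Vertex → ℕ) → ℕ
  Σᵛ f = sum (f ∘ inj₁) + sum (f ∘ inj₂)

  Σᵛ-cong : ∀ {f g} → (∀ x → f x ≡ g x) → Σᵛ f ≡ Σᵛ g
  Σᵛ-cong f≡g = cong₂ _+_ (sum-cong (f≡g ∘ inj₁)) (sum-cong (f≡g ∘ inj₂))

  Σᵛ-≤ : ∀ {f g} → (∀ x → f x ≤ g x) → Σᵛ f ≤ Σᵛ g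
  Σᵛ-≤ f≤g = ℕ.+-mono-≤ (sum-≤ (f≤g ∘ inj₁)) (sum-≤ (f≤g ∘ inj₂))

  Σᵛ-distrib-+ : ∀ f g → Σᵛ (λ x → f x + g x) ≡ Σᵛ f + Σᵛ g
  Σᵛ-distrib-+ f g = trans
    (cong₂ _+_ (sum-distrib-+ (f ∘ inj₁) (g ∘ inj₁)) (sum-distrib-+ (f ∘ inj₂) (g ∘ inj₂)))
    (interchange ℕ.+-commutativeSemigroup (sum (f ∘ inj₁)) _ _ _)

  Σᵛ-sum-comm : ∀ {n} (f : Vertex → Fin n → ℕ) →
    Σᵛ (λ x → ∑[ i < n ] f x i) ≡ ∑[ i < n ] Σᵛ (λ x → f x i)
  Σᵛ-sum-comm f = trans
    (cong₂ _+_ (sum-comm (f ∘ inj₁)) (sum-comm (f ∘ inj₂)))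
    (sym (sum-distrib-+ (λ i → ∑[ x < v ] f (inj₁ x) i) _))

  Σᵛ-single : ∀ f x → (∀ y → y ≢ x → f y ≡ 0) → Σᵛ f ≡ f x
  Σᵛ-single f (inj₁ a) f≡0 = trans
    (cong₂ _+_
      (sum-single _ a λ x x≢a → f≡0 (inj₁ x) (x≢a ∘ ⊎.inj₁-injective))
      (sum-zero _ λ y → f≡0 (inj₂ y) λ ()))
    (ℕ.+-identityʳ _)
  Σᵛ-single f (inj₂ b) f≡0 = cong₂ _+_
    (sum-zero _ λ x → f≡0 (inj₁ x) λ ())
    (sum-single _ b λ y y≢b → f≡0 (inj₂ y) (y≢b ∘ ⊎.inj₂-injective))

  Σᵛ-sift : ∀ x (f : Vertex → ℕ) → Σᵛ (λ y → δᵛ x y * f y) ≡ f x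
  Σᵛ-sift x f = trans
    (Σᵛ-single _ x λ y y≢x → δ-≢-* _≟ᵛ_ (y≢x ∘ sym) (f y)) (δ-≡-* _≟ᵛ_ refl (f x))

  Σᵉ : (Edge → ℕ) → ℕ
  Σᵉ f = ∑[ x < v ] ∑[ y < u ] ∑[ k < ƛ ] f (x , y , k)

  Σᵉ-cong : ∀ {f g} → (∀ e → f e ≡ g e) → Σᵉ f ≡ Σᵉ g
  Σᵉ-cong f≡g = sum-cong λ x → sum-cong λ y → sum-cong λ k → f≡g (x , y , k)

  Σᵉ-const : ∀ c → Σᵉ (λ _ → c) ≡ v * (u * (ƛ * c))
  Σᵉ-const c = trans
    (sum-cong λ x → trans (sum-cong λ y → sum-const ƛ c) (sum-const u _)) (sum-const v _)

  Σᵉ-single : ∀ f e → (∀ e′ → e′ ≢ e → f e′ ≡ 0) → Σᵉ f ≡ f e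
  Σᵉ-single f (x , y , k) f≡0 = trans
    (sum-single _ x λ x′ x′≢x → sum-zero _ λ y′ → sum-zero _ λ k′ → f≡0 _ (x′≢x ∘ cong proj₁))
    (trans
      (sum-single _ y λ y′ y′≢y → sum-zero _ λ k′ → f≡0 _ (y′≢y ∘ cong (proj₁ ∘ proj₂)))
      (sum-single _ k λ k′ k′≢k → f≡0 _ (k′≢k ∘ cong (proj₂ ∘ proj₂))))

  Σᵉ-sum-comm : ∀ {n} (f : Edge → Fin n → ℕ) →
    Σᵉ (λ e → ∑[ i < n ] f e i) ≡ ∑[ i < n ] Σᵉ (λ e → f e i)
  Σᵉ-sum-comm f = trans
    (sum-cong λ x → trans
      (sum-cong λ y → sum-comm λ k → f (x , y , k))
      (sum-comm λ y i → ∑[ k < ƛ ] f (x , y , k) i))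
    (sum-comm λ x i → ∑[ y < u ] ∑[ k < ƛ ] f (x , y , k) i)

  Σᵉ-sift : ∀ e (f : Edge → ℕ) → Σᵉ (λ e′ → δ _≟ᵉ_ e e′ * f e′) ≡ f e
  Σᵉ-sift e f = trans
    (Σᵉ-single _ e λ e′ e′≢e → δ-≢-* _≟ᵉ_ (e′≢e ∘ sym) (f e′)) (δ-≡-* _≟ᵉ_ refl (f e))

  -- Counting the vertices of one cycle; condition (a).

  _∈ᵛ_ : ∀ {m} → Vertex → Cycle G m → Set
  x ∈ᵛ C = ∃ λ j → vertex C j ≡ x

  module _ {m} (C : Cycle G m) where

    on : Vertex → Bool
    on x = does (Fin.any? λ j → vertex C j ≟ᵛ x)

    -- Injectivity of `vertex C` leaves at most one contributing position. The factor `k` makes room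
    -- for a weight that depends on `x`.
    sum-δ-vertex : ∀ x k → ∑[ j < m ] (δᵛ (vertex C j) x * k) ≡ # (on x) * k
    sum-δ-vertex x k with Fin.any? (λ j → vertex C j ≟ᵛ x)
    ... | no x∉C = sum-zero _ λ j → δ-≢-* _≟ᵛ_ (λ eq → x∉C (j , eq)) k
    ... | yes (i , refl) = trans
      (sum-single _ i λ j j≢i → δ-≢-* _≟ᵛ_ (j≢i ∘ vertex-injective C) k)
      (trans (δ-≡-* _≟ᵛ_ {vertex C i} refl k) (sym (ℕ.+-identityʳ k)))

    sum-vertices : ∀ (q : Vertex → ℕ) → Σᵛ (λ x → # (on x) * q x) ≡ ∑[ j < m ] q (vertex C j)
    sum-vertices q = begin
      Σᵛ (λ x → # (on x) * q x)
        ≡⟨ Σᵛ-cong (λ x → sym (sum-δ-vertex x (q x))) ⟩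
      Σᵛ (λ x → ∑[ j < m ] (δᵛ (vertex C j) x * q x))
        ≡⟨ Σᵛ-sum-comm (λ x j → δᵛ (vertex C j) x * q x) ⟩
      ∑[ j < m ] Σᵛ (λ x → δᵛ (vertex C j) x * q x)
        ≡⟨ sum-cong (λ j → Σᵛ-sift (vertex C j) q) ⟩
      ∑[ j < m ] q (vertex C j) ∎
      where open ≡-Reasoning

    sum-vertices-≤ : ∀ q → ∑[ j < m ] q (vertex C j) ≤ Σᵛ q
    sum-vertices-≤ q = subst (_≤ Σᵛ q) (sum-vertices q) (Σᵛ-≤ λ x → #* (on x) (q x))
      where
      #* : ∀ b k → # b * k ≤ k
      #* true  k = ℕ.≤-reflexive (ℕ.+-identityʳ k)
      #* false k = z≤n

    -- The sides V and U alternate along the cycle, so each takes up half of it.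
    side-sum : ∀ (s : Vertex → ℕ) → (∀ a b → s (inj₁ a) + s (inj₂ b) ≡ 1) →
      2 * (∑[ j < m ] s (vertex C j)) ≡ m
    side-sum s s-ends = begin
      2 * S                                               ≡⟨ cong (_+_ S) (ℕ.+-identityʳ S) ⟩
      S + S                                               ≡⟨ cong (_+_ S) (sym (sum-next (s ∘ vertex C))) ⟩
      S + ∑[ j < m ] s (vertex C (next j))                ≡⟨ sym (sum-distrib-+ (s ∘ vertex C) _) ⟩
      ∑[ j < m ] (s (vertex C j) + s (vertex C (next j))) ≡⟨ sum-cong (λ j → ends-sum {edge C j} (joins C j)) ⟩
      ∑[ j < m ] 1                                        ≡⟨ sum-const m 1 ⟩
      m * 1                                               ≡⟨ ℕ.*-identityʳ m ⟩
      m                                                   ∎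
      where
      open ≡-Reasoning
      S = ∑[ j < m ] s (vertex C j)
      ends-sum : ∀ {e x y} → Joins e x y → s x + s y ≡ 1
      ends-sum {a , b , _} (inj₁ refl) = s-ends a b
      ends-sum {a , b , _} (inj₂ refl) = trans (ℕ.+-comm (s (inj₂ b)) _) (s-ends a b)

    ∪-on : (Vertex → Bool) → Vertex → Bool
    ∪-on W x = W x ∨ on x

    ∪-on-⊇ : ∀ W x → W x ≡ true → ∪-on W x ≡ true
    ∪-on-⊇ W x Wx = cong (_∨ on x) Wx

    ∪-on-vertex : ∀ W j → ∪-on W (vertex C j) ≡ true
    ∪-on-vertex W j = trans
      (cong (W (vertex C j) ∨_) (dec-true (Fin.any? λ i → vertex C i ≟ᵛ vertex C j) (j , refl)))
      (∨-zeroʳ (W (vertex C j)))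

    -- Inclusion-exclusion for `W` and the vertex set of `C`, with the intersection counted by
    -- positions on `C`.
    Σᵛ-∪-on : ∀ W → Σᵛ (# ∘ ∪-on W) + ∑[ j < m ] # (W (vertex C j)) ≡ Σᵛ (# ∘ W) + m
    Σᵛ-∪-on W = begin
      Σᵛ (# ∘ ∪-on W) + ∑[ j < m ] # (W (vertex C j))
        ≡⟨ cong (_+_ (Σᵛ (# ∘ ∪-on W))) (sym (sum-vertices (# ∘ W))) ⟩
      Σᵛ (# ∘ ∪-on W) + Σᵛ (λ x → # (on x) * # (W x))
        ≡⟨ sym (Σᵛ-distrib-+ (# ∘ ∪-on W) (λ x → # (on x) * # (W x))) ⟩
      Σᵛ (λ x → # (W x ∨ on x) + # (on x) * # (W x))
        ≡⟨ Σᵛ-cong (λ x → ∨-∧-sum (W x) (on x)) ⟩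
      Σᵛ (λ x → # (W x) + # (on x) * 1)
        ≡⟨ Σᵛ-distrib-+ (# ∘ W) (λ x → # (on x) * 1) ⟩
      Σᵛ (# ∘ W) + Σᵛ (λ x → # (on x) * 1)
        ≡⟨ cong (_+_ (Σᵛ (# ∘ W))) (trans (sum-vertices λ _ → 1)
             (trans (sum-const m 1) (ℕ.*-identityʳ m))) ⟩
      Σᵛ (# ∘ W) + m ∎
      where
      open ≡-Reasoning
      ∨-∧-sum : ∀ p q → # (p ∨ q) + # q * # p ≡ # p + # q * 1
      ∨-∧-sum true  q     = refl
      ∨-∧-sum false true  = refl
      ∨-∧-sum false false = refl

    -- Half of the cycle lies in V and half in U. The indicators of the two sides are the weights
    -- `s`, and neither side has more than `v`, respectively `u`, vertices.
    length-≤ : m ≤ 2 * (v ⊓ u)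
    length-≤ = subst (m ≤_) (sym (ℕ.*-distribˡ-⊓ 2 v u)) (ℕ.⊓-glb
      (bound (λ { (inj₁ _) → 1 ; (inj₂ _) → 0 }) (λ _ _ → refl)
        (trans (cong₂ _+_ (sum-const v 1) (sum-const u 0))
          (trans (cong₂ _+_ (ℕ.*-identityʳ v) (ℕ.*-zeroʳ u)) (ℕ.+-identityʳ v))))
      (bound (λ { (inj₁ _) → 0 ; (inj₂ _) → 1 }) (λ _ _ → refl)
        (trans (cong₂ _+_ (sum-const v 0) (sum-const u 1))
          (cong₂ _+_ (ℕ.*-zeroʳ v) (ℕ.*-identityʳ u)))))
      where
      bound : ∀ {w} (s : Vertex → ℕ) → (∀ a b → s (inj₁ a) + s (inj₂ b) ≡ 1) → Σᵛ s ≡ w → m ≤ 2 * w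
      bound s s-ends refl =
        subst (_≤ 2 * Σᵛ s) (side-sum s s-ends) (ℕ.*-monoʳ-≤ 2 (sum-vertices-≤ s))

  -- Weighted degrees and their parity.

  -- q of the endpoint opposite to y if e is incident with y, and 0 otherwise.
  half : Vertex → (Vertex → ℕ) → Edge → ℕ
  half y q e = let (x , x′) = ends e in δᵛ x y * q x′ + δᵛ x′ y * q x

  -- For constant `q = 1` this is the degree of `y` in `C`; for `q = # ∘ W` it is the number of
  -- edges of `C` from `y` into `W`.
  degree : ∀ {m} → Cycle G m → Vertex → (Vertex → ℕ) → ℕ
  degree {m} C y q = ∑[ j < m ] half y q (edge C j)

  module _ {m} (C : Cycle G m) (y : Vertex) (q : Vertex → ℕ) where

    -- Each edge is seen from both of its ends. Reindexing the second contribution by `next` turns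
    -- it into a sum over the position of `y`, with its predecessor as the opposite end.
    degree-split : degree C y q ≡
      ∑[ j < m ] (δᵛ (vertex C j) y * q (vertex C (next j))) +
      ∑[ j < m ] (δᵛ (vertex C j) y * q (vertex C (prev j)))
    degree-split = begin
      degree C y q
        ≡⟨ sum-cong (λ j → half-joins {edge C j} (joins C j)) ⟩
      ∑[ j < m ] (out j + δᵛ (vertex C (next j)) y * q (vertex C j))
        ≡⟨ sum-cong (λ j →
             cong (λ i → out j + δᵛ (vertex C (next j)) y * q (vertex C i)) (sym (prev-next j))) ⟩
      ∑[ j < m ] (out j + into (next j))
        ≡⟨ sum-distrib-+ out (into ∘ next) ⟩
      sum out + ∑[ j < m ] into (next j)
        ≡⟨ cong (_+_ (sum out)) (sum-next into) ⟩
      sum out + sum into ∎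
      where
      open ≡-Reasoning
      out into : Fin m → ℕ
      out  j = δᵛ (vertex C j) y * q (vertex C (next j))
      into j = δᵛ (vertex C j) y * q (vertex C (prev j))
      half-joins : ∀ {e x x′} → Joins e x x′ → half y q e ≡ δᵛ x y * q x′ + δᵛ x′ y * q x
      half-joins (inj₁ refl) = refl
      half-joins {x = x} {x′} (inj₂ refl) = ℕ.+-comm (δᵛ x′ y * q x) (δᵛ x y * q x′)

    degree-off : ¬ (y ∈ᵛ C) → degree C y q ≡ 0
    degree-off y∉C = trans degree-split (cong₂ _+_ (vanish _) (vanish _))
      where
      vanish : ∀ (f : Fin m → ℕ) → ∑[ j < m ] (δᵛ (vertex C j) y * f j) ≡ 0
      vanish f = sum-zero _ λ j → δ-≢-* _≟ᵛ_ (λ eq → y∉C (j , eq)) (f j)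

    -- Only position `i` carries `y`. In a 2-cycle `next i` and `prev i` coincide, and the two terms
    -- account for the two parallel edges.
    degree-at : ∀ i → vertex C i ≡ y →
      degree C y q ≡ q (vertex C (next i)) + q (vertex C (prev i))
    degree-at i refl = trans degree-split (cong₂ _+_ (pick _) (pick _))
      where
      pick : ∀ (f : Fin m → ℕ) → ∑[ j < m ] (δᵛ (vertex C j) y * f j) ≡ f i
      pick f = trans
        (sum-single _ i λ j j≢i → δ-≢-* _≟ᵛ_ (j≢i ∘ vertex-injective C) (f j))
        (δ-≡-* _≟ᵛ_ {vertex C i} refl (f i))

  degree-even : ∀ {m} (C : Cycle G m) y q → (y ∈ᵛ C → ∀ j → q (vertex C j) ≡ 1) → 2 ∣ degree C y q
  degree-even C y q q≡1 with Fin.any? (λ j → vertex C j ≟ᵛ y)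
  ... | no y∉C = subst (2 ∣_) (sym (degree-off C y q y∉C)) (2 ∣0)
  ... | yes (i , eq) = subst (2 ∣_)
    (sym (trans (degree-at C y q i eq) (cong₂ _+_ (q≡1 (i , eq) _) (q≡1 (i , eq) _)))) ∣-refl

  -- If `y` is on `C`, it is already the single vertex of `C` allowed in `W`, so both of its
  -- neighbours lie outside `W`. In either case the degree is 0.
  degree-even-sparse : ∀ {m} (C : Cycle G m) y (W : Vertex → Bool) → W y ≡ true →
    ∑[ j < m ] # (W (vertex C j)) ≤ 1 → 2 ∣ degree C y (# ∘ W)
  degree-even-sparse C y W Wy sparse with Fin.any? (λ j → vertex C j ≟ᵛ y)
  ... | no y∉C = subst (2 ∣_) (sym (degree-off C y (# ∘ W) y∉C)) (2 ∣0)
  ... | yes (i , refl) = subst (2 ∣_) (sym (trans (degree-at C y (# ∘ W) i refl)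
          (cong₂ _+_ (other (next i) (next≢ (2≤m C) i)) (other (prev i) prev≢)))) (2 ∣0)
    where
    prev≢ : prev i ≢ i
    prev≢ eq = next≢ (2≤m C) i (trans (cong next (sym eq)) (next-prev i))
    other : ∀ j → j ≢ i → # (W (vertex C j)) ≡ 0
    other j j≢i = ℕ.n≤0⇒n≡0 (ℕ.+-cancelʳ-≤ 1 _ 0 (ℕ.≤-trans
      (ℕ.≤-reflexive (cong (λ b → # (W (vertex C j)) + # b) (sym Wy)))
      (ℕ.≤-trans (two-terms≤sum (λ j → # (W (vertex C j))) j i j≢i) sparse)))

  -- `half` cannot distinguish parallel edges, so each pair of vertices contributes a multiple of
  -- `ƛ`.
  half-sum-even : 2 ∣ ƛ → ∀ y q → 2 ∣ Σᵉ (half y q)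
  half-sum-even 2∣ƛ y q = ∣-sum _ λ a → ∣-sum _ λ b →
    subst (2 ∣_) (sym (sum-const ƛ (δᵛ (inj₁ a) y * q (inj₂ b) + δᵛ (inj₂ b) y * q (inj₁ a))))
      (∣m⇒∣m*n _ 2∣ƛ)

  -- The class of parallel edges between two given vertices.

  pairWeight : Fin v → Fin u → Edge → ℕ
  pairWeight a b (x , y , _) = δ Fin._≟_ a x * δ Fin._≟_ b y

  Σᵉ-pairWeight : ∀ a b (f : Edge → ℕ) → Σᵉ (λ e → pairWeight a b e * f e) ≡ ∑[ k < ƛ ] f (a , b , k)
  Σᵉ-pairWeight a b f = trans
    (sum-single _ a λ x x≢a → sum-zero _ λ y → sum-zero _ λ k →
      cong (λ d → d * δ Fin._≟_ b y * f (x , y , k)) (δ-≢ Fin._≟_ (x≢a ∘ sym)))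
    (trans
      (sum-single _ b λ y y≢b → sum-zero _ λ k → cong (_* f (a , y , k))
        (trans (cong (δ Fin._≟_ a a *_) (δ-≢ Fin._≟_ (y≢b ∘ sym))) (ℕ.*-zeroʳ (δ Fin._≟_ a a))))
      (sum-cong λ k → trans
        (cong₂ (λ d d′ → d * d′ * f (a , b , k)) (δ-≡ Fin._≟_ {a} refl) (δ-≡ Fin._≟_ {b} refl))
        (ℕ.+-identityʳ _)))

  2-cycle-pairWeight : (C : Cycle G 2) → ∀ a b → 2 ∣ ∑[ j < 2 ] pairWeight a b (edge C j)
  2-cycle-pairWeight C a b = subst (2 ∣_) (sym eq) (m∣m*n w)
    where
    open ≡-Reasoning
    w = pairWeight a b (edge C zero)
    parallel : ∀ {e e′ x y} → Joins e x y → Joins e′ y x → pairWeight a b e′ ≡ pairWeight a b e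
    -- The two remaining cases would put one vertex on both sides of the bipartition.
    parallel (inj₁ refl) (inj₂ refl) = refl
    parallel (inj₂ refl) (inj₁ refl) = refl
    eq : ∑[ j < 2 ] pairWeight a b (edge C j) ≡ 2 * w
    eq = begin
      ∑[ j < 2 ] pairWeight a b (edge C j)
        ≡⟨ sum-cong {f = pairWeight a b ∘ edge C} {λ _ → w}
             (λ { zero → refl ; (suc zero) → parallel {edge C zero} {edge C (suc zero)} (joins C zero) (joins C (suc zero)) }) ⟩
      ∑[ j < 2 ] w
        ≡⟨ sum-const 2 w ⟩
      2 * w ∎

  -- Double counting of the edges in a decomposition.

  module Decomposition {t} {m : Fin t → ℕ} (cycle : ∀ i → Cycle G (m i))
    (partition : ∀ e → ∃! _≡_ λ i → e ∈ᴱ cycle i) where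

    cycleEdge : ∀ i → Fin (m i) → Edge
    cycleEdge i = edge (cycle i)

    -- Every edge has exactly one address: `partition` fixes the cycle and `edge-injective` the
    -- position in it.
    sum-δ-edge : ∀ e k → ∑[ i < t ] ∑[ j < m i ] (δ _≟ᵉ_ (cycleEdge i j) e * k) ≡ k
    sum-δ-edge e k with partition e
    ... | i , (j , refl) , unique = trans
      (sum-single _ i λ i′ i′≢i → sum-zero _ λ j′ →
        δ-≢-* _≟ᵉ_ (λ eq → i′≢i (sym (unique (j′ , eq)))) k)
      (trans
        (sum-single _ j λ j′ j′≢j → δ-≢-* _≟ᵉ_ (j′≢j ∘ edge-injective (cycle i)) k)
        (δ-≡-* _≟ᵉ_ {cycleEdge i j} refl k))

    -- The double count behind everything below: `f = 1` yields the lengths, `f = half y q` the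
    -- degrees, and `inTwo`, alone or with `pairWeight`, the 2-cycles.
    sum-edges : ∀ f → Σᵉ f ≡ ∑[ i < t ] ∑[ j < m i ] f (cycleEdge i j)
    sum-edges f = begin
      Σᵉ f
        ≡⟨ Σᵉ-cong (λ e → sym (sum-δ-edge e (f e))) ⟩
      Σᵉ (λ e → ∑[ i < t ] ∑[ j < m i ] (δ _≟ᵉ_ (cycleEdge i j) e * f e))
        ≡⟨ Σᵉ-sum-comm _ ⟩
      ∑[ i < t ] Σᵉ (λ e → ∑[ j < m i ] (δ _≟ᵉ_ (cycleEdge i j) e * f e))
        ≡⟨ sum-cong (λ i → trans (Σᵉ-sum-comm _) (sum-cong λ j → Σᵉ-sift (cycleEdge i j) f)) ⟩
      ∑[ i < t ] ∑[ j < m i ] f (cycleEdge i j) ∎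
      where open ≡-Reasoning

    sum-lengths : sum m ≡ v * (u * ƛ)
    sum-lengths = begin
      sum m                          ≡⟨ sum-cong (λ i → sym (trans (sum-const (m i) 1) (ℕ.*-identityʳ (m i)))) ⟩
      ∑[ i < t ] ∑[ j < m i ] 1      ≡⟨ sym (sum-edges λ _ → 1) ⟩
      Σᵉ (λ _ → 1)                   ≡⟨ Σᵉ-const 1 ⟩
      v * (u * (ƛ * 1))              ≡⟨ cong (λ k → v * (u * k)) (ℕ.*-identityʳ ƛ) ⟩
      v * (u * ƛ)                    ∎
      where open ≡-Reasoning

    -- Vertex degrees; condition (b).

    Σᵉ-half-even : ∀ y → 2 ∣ Σᵉ (half y λ _ → 1)
    Σᵉ-half-even y = subst (2 ∣_) (sym (sum-edges (half y λ _ → 1)))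
      (∣-sum _ λ i → degree-even (cycle i) y (λ _ → 1) λ _ _ → refl)

    Σᵉ-half-V : ∀ a → Σᵉ (half (inj₁ a) λ _ → 1) ≡ u * (ƛ * 1)
    Σᵉ-half-V a = begin
      Σᵉ (half (inj₁ a) λ _ → 1)
        ≡⟨ sum-single _ a (λ x x≢a → sum-zero _ λ y → sum-zero _ λ k →
             cong₂ _+_ (δ-≢-* _≟ᵛ_ (x≢a ∘ ⊎.inj₁-injective) 1) (δ-≢-* _≟ᵛ_ (λ ()) 1)) ⟩
      ∑[ y < u ] ∑[ k < ƛ ] half (inj₁ a) (λ _ → 1) (a , y , k)
        ≡⟨ sum-cong (λ y → sum-cong λ k → cong₂ _+_ (δ-≡-* _≟ᵛ_ refl 1) (δ-≢-* _≟ᵛ_ (λ ()) 1)) ⟩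
      ∑[ y < u ] ∑[ k < ƛ ] 1
        ≡⟨ trans (sum-cong λ _ → sum-const ƛ 1) (sum-const u _) ⟩
      u * (ƛ * 1) ∎
      where open ≡-Reasoning

    Σᵉ-half-U : ∀ b → Σᵉ (half (inj₂ b) λ _ → 1) ≡ v * (ƛ * 1)
    Σᵉ-half-U b = begin
      Σᵉ (half (inj₂ b) λ _ → 1)
        ≡⟨ sum-cong (λ x → sum-single _ b λ y y≢b → sum-zero _ λ k →
             cong₂ _+_ (δ-≢-* _≟ᵛ_ (λ ()) 1) (δ-≢-* _≟ᵛ_ (y≢b ∘ ⊎.inj₂-injective) 1)) ⟩
      ∑[ x < v ] ∑[ k < ƛ ] half (inj₂ b) (λ _ → 1) (x , b , k)
        ≡⟨ sum-cong (λ x → sum-cong λ k → cong₂ _+_ (δ-≢-* _≟ᵛ_ (λ ()) 1) (δ-≡-* _≟ᵛ_ refl 1)) ⟩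
      ∑[ x < v ] ∑[ k < ƛ ] 1
        ≡⟨ trans (sum-cong λ _ → sum-const ƛ 1) (sum-const v _) ⟩
      v * (ƛ * 1) ∎
      where open ≡-Reasoning

    degree-V : Fin v → 2 ∣ ƛ * u
    degree-V a = subst (2 ∣_)
      (trans (Σᵉ-half-V a) (trans (cong (u *_) (ℕ.*-identityʳ ƛ)) (ℕ.*-comm u ƛ)))
      (Σᵉ-half-even (inj₁ a))

    degree-U : Fin u → 2 ∣ ƛ * v
    degree-U b = subst (2 ∣_)
      (trans (Σᵉ-half-U b) (trans (cong (v *_) (ℕ.*-identityʳ ƛ)) (ℕ.*-comm v ƛ)))
      (Σᵉ-half-even (inj₂ b))

    -- Growing a vertex set by absorbing cycles; condition (c).

    -- W is the grown vertex set; R marks the cycles that are still available.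
    record Absorption (W₀ : Vertex → Bool) (c : Fin t) (K : ℕ) : Set where
      field
        W      : Vertex → Bool
        R      : Fin t → Bool
        ⊇-W₀   : ∀ x → W₀ x ≡ true → W x ≡ true
        bound  : Σᵛ (# ∘ W) + ∑[ i < t ] (# (R i) * (m i ∸ 2)) ≤ K
        inside : ∀ i → R i ≡ false → i ≢ c → ∀ j → W (vertex (cycle i) j) ≡ true

    meet : (Vertex → Bool) → Fin t → ℕ
    meet W i = ∑[ j < m i ] # (W (vertex (cycle i) j))

    Saturated : ∀ {W₀ c K} → Absorption W₀ c K → Set
    Saturated A = ∀ i → R i ≡ true → meet W i ≤ 1
      where open Absorption A

    -- The left side of `bound` acts as a potential that never increases: absorbing cycle `i` adds
    -- at most `m i ∸ 2` vertices to `W` and takes exactly that term out of the sum over `R`.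
    absorb : ∀ {W₀ c K} (A : Absorption W₀ c K) i →
      Absorption.R A i ≡ true → 2 ≤ meet (Absorption.W A) i → Absorption W₀ c K
    absorb {W₀} {c} {K} A i Ri 2≤meet = record
      { W      = W′
      ; R      = R ⊖ i
      ; ⊇-W₀   = λ x → ∪-on-⊇ (cycle i) W x ∘ ⊇-W₀ x
      ; bound  = bound′
      ; inside = inside′
      }
      where
      open Absorption A
      W′ = ∪-on (cycle i) W
      rest = ∑[ j < t ] (# ((R ⊖ i) j) * (m j ∸ 2))
      growth : Σᵛ (# ∘ W′) ≤ Σᵛ (# ∘ W) + (m i ∸ 2)
      -- The cancelled 2 stands for the vertices of cycle `i` that are already in `W`.
      growth = ℕ.+-cancelʳ-≤ 2 _ _ (begin
        Σᵛ (# ∘ W′) + 2                ≤⟨ ℕ.+-monoʳ-≤ (Σᵛ (# ∘ W′)) 2≤meet ⟩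
        Σᵛ (# ∘ W′) + meet W i         ≡⟨ Σᵛ-∪-on (cycle i) W ⟩
        Σᵛ (# ∘ W) + m i               ≡⟨ cong (_+_ (Σᵛ (# ∘ W))) (sym (ℕ.m∸n+n≡m (2≤m (cycle i)))) ⟩
        Σᵛ (# ∘ W) + (m i ∸ 2 + 2)     ≡⟨ sym (ℕ.+-assoc (Σᵛ (# ∘ W)) (m i ∸ 2) 2) ⟩
        Σᵛ (# ∘ W) + (m i ∸ 2) + 2     ∎)
        where open ℕ.≤-Reasoning
      bound′ : Σᵛ (# ∘ W′) + rest ≤ K
      bound′ = begin
        Σᵛ (# ∘ W′) + rest                                 ≤⟨ ℕ.+-monoˡ-≤ rest growth ⟩
        Σᵛ (# ∘ W) + (m i ∸ 2) + rest                      ≡⟨ ℕ.+-assoc (Σᵛ (# ∘ W)) (m i ∸ 2) rest ⟩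
        Σᵛ (# ∘ W) + (m i ∸ 2 + rest)                      ≡⟨ cong (_+_ (Σᵛ (# ∘ W))) (ℕ.+-comm (m i ∸ 2) rest) ⟩
        Σᵛ (# ∘ W) + (rest + (m i ∸ 2))                    ≡⟨ cong (_+_ (Σᵛ (# ∘ W))) (sum-⊖ R i (λ j → m j ∸ 2) Ri) ⟩
        Σᵛ (# ∘ W) + ∑[ j < t ] (# (R j) * (m j ∸ 2))      ≤⟨ bound ⟩
        K                                                  ∎
        where open ℕ.≤-Reasoning
      inside′ : ∀ i′ → (R ⊖ i) i′ ≡ false → i′ ≢ c → ∀ j → W′ (vertex (cycle i′) j) ≡ true
      inside′ i′ R′i′ i′≢c j with i Fin.≟ i′ | R i′ in Ri′
      ... | yes refl | _     = ∪-on-vertex (cycle i) W j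
      ... | no _     | false = ∪-on-⊇ (cycle i) W _ (inside i′ Ri′ i′≢c j)
      ... | no _     | true  with () ← R′i′

    -- `n` is fuel above the number of available cycles, which drops by one at each absorption. The
    -- factor 1 gives that number the shape of `sum-⊖`.
    saturate : ∀ {W₀ c K} n (A : Absorption W₀ c K) →
      ∑[ i < t ] (# (Absorption.R A i) * 1) < n → Σ (Absorption W₀ c K) Saturated
    saturate (suc n) A R<n
      with Fin.any? (λ i → (Absorption.R A i Bool.≟ true) ×-dec (2 ℕ.≤? meet (Absorption.W A) i))
    ... | yes (i , Ri , 2≤meet) = saturate n (absorb A i Ri 2≤meet)
      (ℕ.≤-trans
        (ℕ.≤-reflexive (trans (ℕ.+-comm 1 _) (sum-⊖ (Absorption.R A) i (λ _ → 1) Ri)))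
        (ℕ.≤-pred R<n))
    ... | no none = A , λ i Ri → ℕ.≤-pred (ℕ.≰⇒> λ 2≤meet → none (i , Ri , 2≤meet))

    module _ (2∣ƛ : 2 ∣ ƛ) (c : Fin t) where

      private
        C = cycle c
        x₀ = vertex C (first (2≤m C))
        x₁ = vertex C (next (first (2≤m C)))
        S = ∑[ i < t ] (# (((λ _ → true) ⊖ c) i) * (m i ∸ 2))

      seed : Vertex → Bool
      seed x = does (x₀ ≟ᵛ x) ∨ does (x₁ ≟ᵛ x)

      start : Absorption seed c (2 + S)
      start = record
        { W      = seed
        ; R      = (λ _ → true) ⊖ c
        ; ⊇-W₀   = λ _ Wx → Wx
        ; bound  = ℕ.+-monoˡ-≤ S (begin
            Σᵛ (# ∘ seed)                                 ≤⟨ Σᵛ-≤ seed-≤ ⟩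
            Σᵛ (λ x → δᵛ x₀ x * 1 + δᵛ x₁ x * 1)          ≡⟨ Σᵛ-distrib-+ (λ x → δᵛ x₀ x * 1) (λ x → δᵛ x₁ x * 1) ⟩
            Σᵛ (λ x → δᵛ x₀ x * 1) + Σᵛ (λ x → δᵛ x₁ x * 1)
              ≡⟨ cong₂ _+_ (Σᵛ-sift x₀ λ _ → 1) (Σᵛ-sift x₁ λ _ → 1) ⟩
            2                                             ∎)
        ; inside = λ i Ri i≢c → contradiction
            (trans (sym (cong not (dec-false (c Fin.≟ i) (i≢c ∘ sym)))) Ri)
            λ ()
        }
        where
        open ℕ.≤-Reasoning
        seed-≤ : ∀ x → # (seed x) ≤ δᵛ x₀ x * 1 + δᵛ x₁ x * 1
        seed-≤ x with x₀ ≟ᵛ x | x₁ ≟ᵛ x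
        ... | yes eq | _      = ℕ.≤-trans (ℕ.≤-reflexive (sym (δ-≡-* _≟ᵛ_ eq 1))) (ℕ.m≤m+n _ _)
        ... | no  _  | yes eq = ℕ.≤-trans (ℕ.≤-reflexive (sym (δ-≡-* _≟ᵛ_ eq 1))) (ℕ.m≤n+m _ _)
        ... | no  _  | no  _  = z≤n

      module _ (A : Absorption seed c (2 + S)) (saturated : Saturated A) where
        open Absorption A

        -- Saturation makes an available cycle meet `W` at most once; an absorbed one lies wholly
        -- inside `W`.
        others-even : ∀ y → W y ≡ true → ∀ i → i ≢ c → 2 ∣ degree (cycle i) y (# ∘ W)
        others-even y Wy i i≢c with R i in Ri
        ... | true  = degree-even-sparse (cycle i) y W Wy (saturated i Ri)
        ... | false = degree-even (cycle i) y (# ∘ W) λ _ j → cong # (inside i Ri i≢c j)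

        neighbours-even : ∀ i → W (vertex C i) ≡ true →
          2 ∣ # (W (vertex C (next i))) + # (W (vertex C (prev i)))
        neighbours-even i Wi = subst (2 ∣_) (degree-at C y (# ∘ W) i refl)
          (∣-sum⇒∣-term (λ i → degree (cycle i) y (# ∘ W)) c (others-even y Wi)
            (subst (2 ∣_) (sum-edges (half y (# ∘ W))) (half-sum-even 2∣ƛ y (# ∘ W))))
          where y = vertex C i

        -- Two consecutive positions are carried along because parity at the later one links its two
        -- neighbours: the earlier one is in `W`, hence so is the following one.
        consecutive : ∀ i → W (vertex C i) ≡ true × W (vertex C (next i)) ≡ true
        consecutive = next-induction (2≤m C) _
          ( ⊇-W₀ x₀ (cong (_∨ does (x₁ ≟ᵛ x₀)) (dec-true (x₀ ≟ᵛ x₀) refl))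
          , ⊇-W₀ x₁ (trans
              (cong (does (x₀ ≟ᵛ x₁) ∨_) (dec-true (x₁ ≟ᵛ x₁) refl)) (∨-zeroʳ (does (x₀ ≟ᵛ x₁)))))
          λ i (Wi , Wi⁺) → Wi⁺ , even⇒true (W (vertex C (next (next i))))
            (subst (λ b → 2 ∣ # (W (vertex C (next (next i)))) + # b)
              (trans (cong (W ∘ vertex C) (prev-next i)) Wi) (neighbours-even (next i) Wi⁺))
          where
          even⇒true : ∀ b → 2 ∣ # b + 1 → b ≡ true
          even⇒true true  _   = refl
          even⇒true false 2∣1 with () ← ∣1⇒≡1 2∣1

        length≤2+S : m c ≤ 2 + S
        length≤2+S = begin
          m c                              ≡⟨ sym (trans (sum-const (m c) 1) (ℕ.*-identityʳ (m c))) ⟩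
          ∑[ j < m c ] 1                   ≡⟨ sum-cong (λ j → cong # (sym (proj₁ (consecutive j)))) ⟩
          ∑[ j < m c ] # (W (vertex C j))  ≤⟨ sum-vertices-≤ C (# ∘ W) ⟩
          -- Adds the excesses of the cycles still available, to reach the left side of `bound`.
          Σᵛ (# ∘ W)                       ≤⟨ ℕ.m≤m+n _ _ ⟩
          _                                ≤⟨ bound ⟩
          2 + S                            ∎
          where open ℕ.≤-Reasoning

      excess-≤ : m c ∸ 2 ≤ S
      excess-≤ = ℕ.m≤n+o⇒m∸n≤o (m c) 2
        (let (A , saturated) = saturate _ start ℕ.≤-refl in length≤2+S A saturated)

      -- Twice (c), free of division and subtraction. All the excesses `m i ∸ 2` together with
      -- `2 * t` make up the number of edges, and by `excess-≤` the excess of `c` is at most that of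
      -- the other cycles combined.
      number-of-cycles-≤ : 2 * t + 2 * m c ≤ v * (u * ƛ) + 4
      number-of-cycles-≤ = begin
        2 * t + 2 * m c                       ≡⟨ cong (λ k → 2 * t + 2 * k) (sym (ℕ.m∸n+n≡m (2≤m C))) ⟩
        2 * t + 2 * (d + 2)
          ≡⟨ solve 2 (λ t d → con 2 :* t :+ con 2 :* (d :+ con 2) := (d :+ d :+ t :* con 2) :+ con 4) refl t d ⟩
        d + d + t * 2 + 4                     ≤⟨ ℕ.+-monoˡ-≤ 4 (ℕ.+-monoˡ-≤ (t * 2) (ℕ.+-monoˡ-≤ d excess-≤)) ⟩
        S + d + t * 2 + 4                     ≡⟨ cong (_+ 4) excess-sum ⟩
        v * (u * ƛ) + 4                       ∎
        where
        open ℕ.≤-Reasoning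
        open ℕSolver.+-*-Solver
        d = m c ∸ 2
        excess-sum : S + d + t * 2 ≡ v * (u * ƛ)
        excess-sum = begin-equality
          S + d + t * 2
            ≡⟨ cong₂ _+_ (sum-⊖ (λ _ → true) c (λ i → m i ∸ 2) refl) (sym (sum-const t 2)) ⟩
          ∑[ i < t ] (1 * (m i ∸ 2)) + ∑[ i < t ] 2
            ≡⟨ sym (sum-distrib-+ (λ i → 1 * (m i ∸ 2)) _) ⟩
          ∑[ i < t ] (1 * (m i ∸ 2) + 2)
            ≡⟨ sum-cong (λ i → trans (cong (_+ 2) (ℕ.*-identityˡ _)) (ℕ.m∸n+n≡m (2≤m (cycle i)))) ⟩
          sum m
            ≡⟨ sum-lengths ⟩
          v * (u * ƛ) ∎

    -- Edges lying in 2-cycles; condition (d).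

    isTwo : Fin t → ℕ
    isTwo i = δ ℕ._≟_ (m i) 2

    inTwo : Edge → ℕ
    inTwo e = isTwo (proj₁ (partition e))

    inTwo-cycleEdge : ∀ i j → inTwo (cycleEdge i j) ≡ isTwo i
    inTwo-cycleEdge i j = cong isTwo (proj₂ (proj₂ (partition (cycleEdge i j))) (j , refl))

    -- Sorted by cycle, a 2-cycle contributes both of its edges or neither, and a longer cycle
    -- contributes nothing.
    2-cycles-on-pair-even : ∀ a b → 2 ∣ ∑[ k < ƛ ] inTwo (a , b , k)
    2-cycles-on-pair-even a b = subst (2 ∣_)
      (trans (sym (sum-edges λ e → pairWeight a b e * inTwo e)) (Σᵉ-pairWeight a b inTwo))
      (∣-sum _ even)
      where
      2-cycle : ∀ {m} (C : Cycle G m) → m ≡ 2 → 2 ∣ ∑[ j < m ] pairWeight a b (edge C j)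
      2-cycle C refl = 2-cycle-pairWeight C a b
      even : ∀ i → 2 ∣ ∑[ j < m i ] (pairWeight a b (cycleEdge i j) * inTwo (cycleEdge i j))
      even i with m i ℕ.≟ 2
      ... | yes mi≡2 = subst (2 ∣_)
        (sum-cong λ j → sym (trans
          (cong (pairWeight a b (cycleEdge i j) *_) (trans (inTwo-cycleEdge i j) (δ-≡ ℕ._≟_ mi≡2)))
          (ℕ.*-identityʳ _)))
        (2-cycle (cycle i) mi≡2)
      ... | no mi≢2 = ∣-sum _ λ j → subst (2 ∣_)
        (sym (trans
          (cong (pairWeight a b (cycleEdge i j) *_) (trans (inTwo-cycleEdge i j) (δ-≢ ℕ._≟_ mi≢2)))
          (ℕ.*-zeroʳ (pairWeight a b (cycleEdge i j)))))
        (2 ∣0)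

    -- The count is even and at most `ƛ`, so it cannot equal the odd number `ƛ`.
    2-cycles-on-pair-≤ : ¬ (2 ∣ ƛ) → ∀ a b → ∑[ k < ƛ ] inTwo (a , b , k) ≤ ƛ ∸ 1
    2-cycles-on-pair-≤ 2∤ƛ a b = ℕ.<⇒≤pred (ℕ.≤∧≢⇒<
      (ℕ.≤-trans (sum-≤ λ k → δ-≤1 ℕ._≟_ _ _) (ℕ.≤-reflexive (trans (sum-const ƛ 1) (ℕ.*-identityʳ ƛ))))
      λ eq → 2∤ƛ (subst (2 ∣_) eq (2-cycles-on-pair-even a b)))

    -- The left side counts the edges in 2-cycles, two for each; the right side bounds them pair by
    -- pair.
    2-cycles-≤ : ¬ (2 ∣ ƛ) → 2 * sum isTwo ≤ v * (u * (ƛ ∸ 1))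
    2-cycles-≤ 2∤ƛ = begin
      2 * sum isTwo
        ≡⟨ *-distribˡ-sum 2 isTwo ⟩
      ∑[ i < t ] (2 * isTwo i)
        ≡⟨ sum-cong (λ i → sym (trans (sum-const (m i) (isTwo i)) (length-isTwo i))) ⟩
      ∑[ i < t ] ∑[ j < m i ] isTwo i
        ≡⟨ sum-cong (λ i → sum-cong λ j → sym (inTwo-cycleEdge i j)) ⟩
      ∑[ i < t ] ∑[ j < m i ] inTwo (cycleEdge i j)
        ≡⟨ sym (sum-edges inTwo) ⟩
      Σᵉ inTwo
        ≤⟨ sum-≤ (λ a → sum-≤ λ b → 2-cycles-on-pair-≤ 2∤ƛ a b) ⟩
      ∑[ a < v ] ∑[ b < u ] (ƛ ∸ 1)
        ≡⟨ trans (sum-cong λ _ → sum-const u _) (sum-const v _) ⟩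
      v * (u * (ƛ ∸ 1)) ∎
      where
      open ℕ.≤-Reasoning
      length-isTwo : ∀ i → m i * isTwo i ≡ 2 * isTwo i
      length-isTwo i with m i ℕ.≟ 2
      ... | yes mi≡2 = cong (_* isTwo i) mi≡2
      ... | no  mi≢2 = trans
        (trans (cong (m i *_) (δ-≢ ℕ._≟_ mi≢2)) (ℕ.*-zeroʳ (m i))) (sym (cong (2 *_) (δ-≢ ℕ._≟_ mi≢2)))

-- From indexed families and natural numbers to the stated form.

last≡lookup : ∀ {n} (M : Vec ℕ (suc n)) → last M ≡ lookup M (fromℕ n)
last≡lookup (x ∷ [])     = refl
last≡lookup (x ∷ y ∷ M) = last≡lookup (y ∷ M)

ν≡sum : ∀ {t} k (M : Vec ℕ t) → ν k M ≡ ∑[ i < t ] δ ℕ._≟_ (lookup M i) k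
ν≡sum k []      = sym (sum-[] _)
ν≡sum k (x ∷ M) = begin
  ν k (x ∷ M)                                 ≡⟨ if-suc (does (x ℕ.≟ k)) (ν k M) ⟩
  # (does (x ℕ.≟ k)) + ν k M                  ≡⟨ cong₂ _+_ (sym (δ-does ℕ._≟_ x k)) (ν≡sum k M) ⟩
  δ ℕ._≟_ x k + ∑[ i < _ ] δ ℕ._≟_ (lookup M i) k ≡⟨ sym (sum-suc _) ⟩
  ∑[ i < _ ] δ ℕ._≟_ (lookup (x ∷ M) i) k     ∎
  where
  open ≡-Reasoning
  if-suc : ∀ b n → (if b then suc else id) n ≡ # b + n
  if-suc true  n = refl
  if-suc false n = refl

ℤ-bound : ∀ t k m → t + m ≤ k + 2 → + t ℤ.≤ + k ℤ.- + m ℤ.+ + 2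
ℤ-bound t k m t+m≤k+2 = begin
  + t                         ≡⟨ solve-t ⟩
  + (t + m) ℤ.- + m           ≤⟨ ℤ.+-monoˡ-≤ (ℤ.- + m) (ℤ.+≤+ t+m≤k+2) ⟩
  + (k + 2) ℤ.- + m           ≡⟨ solve-k ⟩
  + k ℤ.- + m ℤ.+ + 2         ∎
  where
  open ℤ.≤-Reasoning
  open ℤSolver.+-*-Solver
  solve-t : + t ≡ + (t + m) ℤ.- + m
  solve-t = trans (solve 2 (λ t m → t := t :+ m :- m) refl (+ t) (+ m))
    (cong (ℤ._- + m) (sym (ℤ.pos-+ t m)))
  solve-k : + (k + 2) ℤ.- + m ≡ + k ℤ.- + m ℤ.+ + 2
  solve-k = trans (cong (ℤ._- + m) (ℤ.pos-+ k 2))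
    (solve 2 (λ k m → k :+ con (+ 2) :- m := k :- m :+ con (+ 2)) refl (+ k) (+ m))

theorem2 : (ƛ v u : ℕ) .{{_ : NonZero ƛ}} .{{_ : NonZero v}} .{{_ : NonZero u}} →
    (n : ℕ) → let t = suc n in
    (M : Vec ℕ t) → Linked _≤_ M → All (2 ∣_) M →
    CycleDecomposition M (completeBipartite ƛ v u) →
    (last M ≤ 2 * (v ⊓ u))
    × (2 ∣ ƛ * v × 2 ∣ ƛ * u)
    × (2 ∣ ƛ → + t ℤ.≤ + (ƛ / 2 * v * u) ℤ.- + last M ℤ.+ + 2)
    × (¬ (2 ∣ ƛ) → 2 * ν 2 M ≤ (ƛ ∸ 1) * v * u)
theorem2 ƛ v@(suc _) u@(suc _) n M _ _ decomposition rewrite last≡lookup M =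
    length-≤ (cycle c)
  -- A vertex of U has degree `ƛ * v` and one of V has degree `ƛ * u`; both sides are nonempty, so
  -- `zero` is available.
  , (degree-U zero , degree-V zero)
  , (λ 2∣ƛ → ℤ-bound (suc n) (ƛ / 2 * v * u) (lookup M c)
      (ℕ.*-cancelˡ-≤ 2 (ℕ.≤-trans
        (ℕ.≤-reflexive (ℕ.*-distribˡ-+ 2 (suc n) (lookup M c)))
        (ℕ.≤-trans (number-of-cycles-≤ 2∣ƛ c) (ℕ.≤-reflexive (half-edges 2∣ƛ))))))
  , λ 2∤ƛ → begin
      2 * ν 2 M            ≡⟨ cong (2 *_) (ν≡sum 2 M) ⟩
      2 * sum isTwo        ≤⟨ 2-cycles-≤ 2∤ƛ ⟩
      v * (u * (ƛ ∸ 1))    ≡⟨ rotate v u (ƛ ∸ 1) ⟩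
      (ƛ ∸ 1) * v * u      ∎
  where
  open CycleDecomposition decomposition
  open Decomposition cycle partition
  open ℕ.≤-Reasoning
  open ℕSolver.+-*-Solver
  c = fromℕ n
  rotate : ∀ v u k → v * (u * k) ≡ k * v * u
  rotate = solve 3 (λ v u k → v :* (u :* k) := k :* v :* u) refl
  -- Evenness makes the truncating division `ƛ / 2` exact.
  half-edges : 2 ∣ ƛ → v * (u * ƛ) + 4 ≡ 2 * (ƛ / 2 * v * u + 2)
  half-edges 2∣ƛ = trans
    (cong (λ k → v * (u * k) + 4) (sym (m/n*n≡m 2∣ƛ)))
    (solve 3 (λ v u k → v :* (u :* (k :* con 2)) :+ con 4 := con 2 :* (k :* v :* u :+ con 2)) refl v u (ƛ / 2))
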